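{- Fix an integer $m\geq 0$. For integers $n\geq m$ and $0\leq k\leq n-m$ let $$NA_{\langle m\rangle}(n,k)=\frac{m+1}{n+2}\binom{n+2}{k+1}\binom{n-m}{k},$$ and set $NA_{\langle m\rangle}(n,k)=0$ for $k>n-m$. Consider the infinite lower-triangular matrices $$N_{A,\langle m\rangle}=\left[NA_{\langle m\rangle}(n,k)\right]_{n\geq m,\ k\geq 0}\quad\text{and}\quad \overleftarrow{N}_{A,\langle m\rangle}=\left[NA_{\langle m\rangle}(n,n-m-k)\right]_{n\geq m,\ k\geq 0},$$ where rows are indexed by $n\ge m$, columns by $k\ge 0$, and the entries with $k>n-m$ are $0$. Then both $N_{A,\langle m\rangle}$ and $\overleftarrow{N}_{A,\langle m\rangle}$ are totally positive.
   Context: A (finite or infinite) real matrix is totally positive (TP) if all of its minors are nonnegative. -}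

module Defs where

open import Data.Nat as ℕ using (ℕ; zero; suc; _≤?_)
open import Data.Nat.Combinatorics using (_C_)
open import Data.Integer using (+_)
open import Data.Fin using (Fin; zero; suc; punchIn) renaming (_<_ to _<ᶠ_)
open import Data.Rational using (ℚ; 0ℚ; 1ℚ; _+_; _*_; -_; _/_; _≤_)
open import Relation.Nullary using (yes; no)

sumFin : ∀ n → (Fin n → ℚ) → ℚ
sumFin zero    f = 0ℚ
sumFin (suc n) f = f zero + sumFin n (λ j → f (suc j))

altSign : ℕ → ℚ
altSign zero    = 1ℚ
altSign (suc j) = - altSign j

det : ∀ n → (Fin n → Fin n → ℚ) → ℚ
det zero    M = 1ℚ
det (suc n) M =
  sumFin (suc n) (λ j → altSign (Data.Fin.toℕ j) * M zero j
                        * det n (λ r c → M (suc r) (punchIn j c)))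

StrictlyIncreasing : ∀ {p} → (Fin p → ℕ) → Set
StrictlyIncreasing {p} r = ∀ (a b : Fin p) → a <ᶠ b → r a ℕ.< r b

TotallyPositive : (ℕ → ℕ → ℚ) → Set
TotallyPositive A =
  ∀ (p : ℕ) (rows cols : Fin p → ℕ) →
  StrictlyIncreasing rows → StrictlyIncreasing cols →
  0ℚ ≤ det p (λ a b → A (rows a) (cols b))

-- NA_<m>(n,k) with n = m + i  (so i = n - m ≥ 0):
--   (m+1)/(n+2) * C(n+2,k+1) * C(n-m,k)  if k ≤ n - m, and 0 otherwise.
NA : (m i k : ℕ) → ℚ
NA m i k with k ≤? i
... | yes _ = (+ ((suc m) ℕ.* ((suc (suc (m ℕ.+ i))) C (suc k)) ℕ.* (i C k)))
                / suc (suc (m ℕ.+ i))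
... | no _  = 0ℚ

-- The matrix N_{A,<m>}: row index i corresponds to n = m + i, column k.
NAmatrix : ℕ → ℕ → ℕ → ℚ
NAmatrix m i k = NA m i k

NArevMatrix : ℕ → ℕ → ℕ → ℚ
NArevMatrix m i k with k ≤? i
... | yes _ = NA m i (i ℕ.∸ k)
... | no _  = 0ℚ

{-# OPTIONS --safe #-}

-- For nonnegative weights c let V₀ = V₁ = 1 and V_{j+2} = V_{j+1} + c_j y V_j, the matching
-- polynomials of a weighted path, and let V be the matrix of their coefficients. Since each row
-- of V is the previous one plus a multiple of a shifted earlier one, V is obtained from 1 ⊕ V by
-- repeating and rescaling rows and then taking partial sums of the rows. These operations preserve
-- nonnegativity of minors and 1 ⊕ V has one column more than V, so V is totally positive by
-- induction on the number of columns.
-- With c_{2i} = i+s+1 and c_{2i+1} = i+1 one finds V_{2i,k} = k! C(i,k) C(i+s,k). Both matrices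
-- are the even rows of such a V up to positive row and column factors:
--   NA(i,k)   = (m+1) · V_{2i,k} / (k+1)!                            with s = m+1,
--   NA(i,i-k) = (m+1) (i+m+1)! / (i+1)! · V_{2i,k} / (k+m+1)!        with s = 1.

module Submission where

open import Defs
open import Data.Nat using (ℕ)
open import Data.Product using (_×_)

open import Data.Nat as ℕ using (zero; suc; z≤n; s≤s; z<s; pred; _!)
import Data.Nat.Properties as ℕₚ
open import Data.Nat.Combinatorics using (_C_; nCk+nC[k+1]≡[n+1]C[k+1]; k>n⇒nCk≡0; nCk≡n!/k![n-k]!; nCk≡nC[n∸k]; k![n∸k]!∣n!)
open import Data.Nat.DivMod using (m/n*n≡m)
open import Data.Nat.Tactic.RingSolver using (solve-∀)
import Data.Integer as ℤ
open import Data.Integer using () renaming (+_ to pos)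
import Data.Integer.Properties as ℤₚ
open import Data.Fin as Fin using (Fin; zero; suc; toℕ; punchIn; inject₁; lift)
import Data.Fin.Properties as Finₚ
open import Data.Rational using (ℚ; 0ℚ; 1ℚ; _+_; _*_; -_; _/_; _≤_; toℚᵘ; nonNegative)
import Data.Rational.Properties as ℚₚ
import Data.Rational.Unnormalised as ℚᵘ
import Data.Rational.Unnormalised.Properties as ℚᵘₚ
open import Data.Rational.Solver using (module +-*-Solver)
open import Data.Product using (∃; _,_)
open import Data.Sum using (inj₁; inj₂)
open import Data.Vec.Functional using (updateAt)
open import Data.Vec.Functional.Properties using (updateAt-updates; updateAt-minimal)
open import Function using (_∘_; const)
open import Relation.Binary.Definitions using (tri<; tri≈; tri>)
open import Relation.Nullary using (Dec; yes; no; contradiction)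
open import Relation.Binary.PropositionalEquality using (_≡_; _≢_; _≗_; refl; sym; trans; cong; cong₂; subst; module ≡-Reasoning)

open +-*-Solver using (_:=_; _:+_; _:*_; :-_; con) renaming (solve to solveℚ)

-- Finite sums and products of rationals

*-nonNeg : ∀ {x y} → 0ℚ ≤ x → 0ℚ ≤ y → 0ℚ ≤ x * y
*-nonNeg {x} {y} 0≤x 0≤y =
  subst (_≤ x * y) (ℚₚ.*-zeroʳ x) (ℚₚ.*-monoˡ-≤-nonNeg x {{nonNegative 0≤x}} 0≤y)

sumFin-cong : ∀ n {f g : Fin n → ℚ} → f ≗ g → sumFin n f ≡ sumFin n g
sumFin-cong zero    f≗g = refl
sumFin-cong (suc n) f≗g = cong₂ _+_ (f≗g zero) (sumFin-cong n (f≗g ∘ suc))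

sumFin-zero : ∀ n {f : Fin n → ℚ} → (∀ i → f i ≡ 0ℚ) → sumFin n f ≡ 0ℚ
sumFin-zero zero    f≡0 = refl
sumFin-zero (suc n) f≡0 = cong₂ _+_ (f≡0 zero) (sumFin-zero n (f≡0 ∘ suc))

sumFin-+ : ∀ n (f g : Fin n → ℚ) → sumFin n (λ i → f i + g i) ≡ sumFin n f + sumFin n g
sumFin-+ zero    f g = refl
sumFin-+ (suc n) f g = trans (cong ((f zero + g zero) +_) (sumFin-+ n (f ∘ suc) (g ∘ suc)))
  (solveℚ 4 (λ a b c d → (a :+ b) :+ (c :+ d) := (a :+ c) :+ (b :+ d)) refl
    (f zero) (g zero) (sumFin n (f ∘ suc)) (sumFin n (g ∘ suc)))

sumFin-*ˡ : ∀ n x (f : Fin n → ℚ) → sumFin n (λ i → x * f i) ≡ x * sumFin n f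
sumFin-*ˡ zero    x f = sym (ℚₚ.*-zeroʳ x)
sumFin-*ˡ (suc n) x f = trans (cong ((x * f zero) +_) (sumFin-*ˡ n x (f ∘ suc)))
  (sym (ℚₚ.*-distribˡ-+ x (f zero) (sumFin n (f ∘ suc))))

prodFin : ∀ n → (Fin n → ℚ) → ℚ
prodFin zero    f = 1ℚ
prodFin (suc n) f = f zero * prodFin n (f ∘ suc)

prodFin-nonNeg : ∀ n {f : Fin n → ℚ} → (∀ i → 0ℚ ≤ f i) → 0ℚ ≤ prodFin n f
prodFin-nonNeg zero    0≤f = ℚₚ.nonNegative⁻¹ 1ℚ
prodFin-nonNeg (suc n) 0≤f = *-nonNeg (0≤f zero) (prodFin-nonNeg n (0≤f ∘ suc))

prodFin-punchIn : ∀ n (j : Fin (suc n)) (f : Fin (suc n) → ℚ) →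
  f j * prodFin n (f ∘ punchIn j) ≡ prodFin (suc n) f
prodFin-punchIn n       zero    f = refl
prodFin-punchIn (suc n) (suc j) f = trans
  (solveℚ 3 (λ a b c → a :* (b :* c) := b :* (a :* c)) refl
    (f (suc j)) (f zero) (prodFin n (f ∘ suc ∘ punchIn j)))
  (cong (f zero *_) (prodFin-punchIn n j (f ∘ suc)))

-- Determinants

minor : ∀ {n} → (Fin (suc n) → Fin (suc n) → ℚ) → Fin (suc n) → Fin n → Fin n → ℚ
minor M j r c = M (suc r) (punchIn j c)

laplaceTerm : ∀ n → (Fin (suc n) → Fin (suc n) → ℚ) → Fin (suc n) → ℚ
laplaceTerm n M j = altSign (toℕ j) * M zero j * det n (minor M j)

det-cong : ∀ n {M N : Fin n → Fin n → ℚ} → (∀ a b → M a b ≡ N a b) → det n M ≡ det n N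
det-cong zero    M≡N = refl
det-cong (suc n) M≡N = sumFin-cong (suc n) λ j →
  cong₂ _*_ (cong (altSign (toℕ j) *_) (M≡N zero j))
            (det-cong n λ r c → M≡N (suc r) (punchIn j c))

-- Phrased for three matrices that agree off row `a`, so that it applies to minors with different
-- row selections. Row 0 splits in the expansion itself; a later row lies in every minor of it.
det-additive : ∀ n (a : Fin n) (M M₁ M₂ : Fin n → Fin n → ℚ) →
  (∀ b → b ≢ a → M b ≗ M₁ b) → (∀ b → b ≢ a → M b ≗ M₂ b) →
  (∀ j → M a j ≡ M₁ a j + M₂ a j) → det n M ≡ det n M₁ + det n M₂
det-additive (suc n) zero M M₁ M₂ M≗M₁ M≗M₂ Ma = trans
  (sumFin-cong (suc n) λ j → trans
    (cong (λ z → altSign (toℕ j) * z * det n (minor M j)) (Ma j))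
    (trans
      (solveℚ 4 (λ s x y d → s :* (x :+ y) :* d := s :* x :* d :+ s :* y :* d) refl
        (altSign (toℕ j)) (M₁ zero j) (M₂ zero j) (det n (minor M j)))
      (cong₂ _+_
        (cong (altSign (toℕ j) * M₁ zero j *_) (det-cong n λ r c → M≗M₁ (suc r) (λ ()) (punchIn j c)))
        (cong (altSign (toℕ j) * M₂ zero j *_) (det-cong n λ r c → M≗M₂ (suc r) (λ ()) (punchIn j c))))))
  (sumFin-+ (suc n) (laplaceTerm n M₁) (laplaceTerm n M₂))
det-additive (suc n) (suc a) M M₁ M₂ M≗M₁ M≗M₂ Ma = trans
  (sumFin-cong (suc n) λ j → trans
    (cong (altSign (toℕ j) * M zero j *_)
      (det-additive n a (minor M j) (minor M₁ j) (minor M₂ j)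
        (λ b b≢a c → M≗M₁ (suc b) (b≢a ∘ Finₚ.suc-injective) (punchIn j c))
        (λ b b≢a c → M≗M₂ (suc b) (b≢a ∘ Finₚ.suc-injective) (punchIn j c))
        (λ c → Ma (punchIn j c))))
    (trans (ℚₚ.*-distribˡ-+ (altSign (toℕ j) * M zero j) (det n (minor M₁ j)) (det n (minor M₂ j)))
      (cong₂ _+_
        (cong (λ z → altSign (toℕ j) * z * det n (minor M₁ j)) (M≗M₁ zero (λ ()) j))
        (cong (λ z → altSign (toℕ j) * z * det n (minor M₂ j)) (M≗M₂ zero (λ ()) j)))))
  (sumFin-+ (suc n) (laplaceTerm n M₁) (laplaceTerm n M₂))

-- The expansion of a determinant along two equal rows v, with the remaining minors abstracted
-- to a function G of the remaining columns: the pairs of columns {0, j} cancel, and what is left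
-- has the same shape with one column fewer.
pairs-cancel : ∀ n (v : Fin (suc (suc n)) → ℚ) (G : (Fin n → Fin (suc (suc n))) → ℚ) →
  (∀ {g h} → g ≗ h → G g ≡ G h) →
  sumFin (suc (suc n)) (λ j → altSign (toℕ j) * v j *
    sumFin (suc n) (λ l → altSign (toℕ l) * v (punchIn j l) * G (punchIn j ∘ punchIn l))) ≡ 0ℚ
pairs-cancel n v G G-cong = begin
  1ℚ * v zero * sumFin (suc n) first + sumFin (suc n) others
    ≡⟨ cong (_+ sumFin (suc n) others) (sumFin-*ˡ (suc n) (1ℚ * v zero) first) ⟨
  sumFin (suc n) (λ l → 1ℚ * v zero * first l) + sumFin (suc n) others
    ≡⟨ sumFin-+ (suc n) (λ l → 1ℚ * v zero * first l) others ⟨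
  sumFin (suc n) (λ l → 1ℚ * v zero * first l + others l)
    ≡⟨ sumFin-cong (suc n) (λ l →
         solveℚ 5 (λ a b g t i → con 1ℚ :* a :* (t :* b :* g) :+ :- t :* b :* (con 1ℚ :* a :* g :+ i)
                     := t :* b :* (:- i)) refl
           (v zero) (v (suc l)) (G (suc ∘ punchIn l)) (s l) (inner l)) ⟩
  sumFin (suc n) (λ l → s l * v (suc l) * (- inner l))
    ≡⟨ rest n v G G-cong ⟩
  0ℚ ∎
  where
  open ≡-Reasoning
  s : ∀ {m} → Fin m → ℚ
  s j = altSign (toℕ j)
  inner : Fin (suc n) → ℚ
  inner l = sumFin n (λ k → - s k * v (suc (punchIn l k)) * G (punchIn (suc l) ∘ punchIn (suc k)))
  first : Fin (suc n) → ℚ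
  first l = s l * v (suc l) * G (suc ∘ punchIn l)
  others : Fin (suc n) → ℚ
  others l = - s l * v (suc l) * (1ℚ * v zero * G (suc ∘ punchIn l) + inner l)
  -- In every pair of columns still present, column 0 survives the deletion. The sum is therefore
  -- the same expansion over `v ∘ suc`, with `lift 1` carrying column 0 along inside `G`.
  rest : ∀ n (v : Fin (suc (suc n)) → ℚ) (G : (Fin n → Fin (suc (suc n))) → ℚ) →
    (∀ {g h} → g ≗ h → G g ≡ G h) →
    sumFin (suc n) (λ l → s l * v (suc l) * (-
      sumFin n (λ k → - s k * v (suc (punchIn l k)) * G (punchIn (suc l) ∘ punchIn (suc k))))) ≡ 0ℚ
  rest zero    v G G-cong = sumFin-zero 1 λ l → ℚₚ.*-zeroʳ (s l * v (suc l))
  rest (suc n) v G G-cong = trans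
    (sumFin-cong (suc (suc n)) λ l → cong (s l * v (suc l) *_) (trans
      (cong -_ (trans
        (sumFin-cong (suc n) λ k → trans
          (cong (- s k * v (suc (punchIn l k)) *_)
            (G-cong {punchIn (suc l) ∘ punchIn (suc k)} {lift 1 (punchIn l ∘ punchIn k)}
              λ { zero → refl ; (suc c) → refl }))
          (solveℚ 3 (λ t x g → :- t :* x :* g := :- con 1ℚ :* (t :* x :* g)) refl
            (s k) (v (suc (punchIn l k))) (G (lift 1 (punchIn l ∘ punchIn k)))))
        (sumFin-*ˡ (suc n) (- 1ℚ) (smaller l))))
      (solveℚ 1 (λ x → :- (:- con 1ℚ :* x) := x) refl (sumFin (suc n) (smaller l)))))
    (pairs-cancel n (v ∘ suc) (G ∘ lift 1)
      (λ g≗h → G-cong λ { zero → refl ; (suc c) → cong suc (g≗h c) }))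
    where
    smaller : Fin (suc (suc n)) → Fin (suc n) → ℚ
    smaller l k = s k * v (suc (punchIn l k)) * G (lift 1 (punchIn l ∘ punchIn k))

-- Expanding along two equal top rows leaves minors determined by the remaining columns, the
-- situation of `pairs-cancel`. A lower pair of equal rows lies in every minor of the first
-- expansion.
det-adjacent-equal : ∀ n (a : Fin n) (M : Fin (suc n) → Fin (suc n) → ℚ) →
  M (inject₁ a) ≗ M (suc a) → det (suc n) M ≡ 0ℚ
det-adjacent-equal (suc n) zero M M₀≗M₁ = trans
  (sumFin-cong (suc (suc n)) λ j →
    cong (altSign (toℕ j) * M zero j *_) (sumFin-cong (suc n) λ l →
      cong (λ z → altSign (toℕ l) * z * det n (λ r c → M (suc (suc r)) (punchIn j (punchIn l c))))
        (sym (M₀≗M₁ (punchIn j l)))))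
  (pairs-cancel n (M zero) (λ g → det n (λ r c → M (suc (suc r)) (g c)))
    (λ g≗h → det-cong n λ r c → cong (M (suc (suc r))) (g≗h c)))
det-adjacent-equal (suc n) (suc a) M Ma = sumFin-zero (suc (suc n)) λ j → trans
  (cong (altSign (toℕ j) * M zero j *_)
    (det-adjacent-equal n a (λ r c → M (suc r) (punchIn j c)) (λ c → Ma (punchIn j c))))
  (ℚₚ.*-zeroʳ (altSign (toℕ j) * M zero j))

det-zero-row : ∀ n (M : Fin (suc n) → Fin (suc n) → ℚ) →
  (∀ j → M zero j ≡ 0ℚ) → det (suc n) M ≡ 0ℚ
det-zero-row n M M₀≡0 = sumFin-zero (suc n) λ j →
  trans (cong (λ z → altSign (toℕ j) * z * det n (minor M j)) (M₀≡0 j))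
    (solveℚ 2 (λ t x → t :* con 0ℚ :* x := con 0ℚ) refl (altSign (toℕ j)) (det n (minor M j)))

-- In the expansion along row 0 the first term has a zero entry, and every other minor keeps the
-- zero column as its first column.
det-zero-column : ∀ n (M : Fin (suc n) → Fin (suc n) → ℚ) →
  (∀ i → M i zero ≡ 0ℚ) → det (suc n) M ≡ 0ℚ
det-zero-column zero    M M≡0 = det-zero-row 0 M λ { zero → M≡0 zero }
det-zero-column (suc n) M M≡0 = cong₂ _+_
  (trans (cong (λ z → 1ℚ * z * det (suc n) (minor M zero)) (M≡0 zero))
    (solveℚ 1 (λ x → con 1ℚ :* con 0ℚ :* x := con 0ℚ) refl (det (suc n) (minor M zero))))
  (sumFin-zero (suc n) λ j → trans
    (cong (altSign (suc (toℕ j)) * M zero (suc j) *_)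
      (det-zero-column n (minor M (suc j)) (λ i → M≡0 (suc i))))
    (ℚₚ.*-zeroʳ (altSign (suc (toℕ j)) * M zero (suc j))))

det-unit-row : ∀ n (M : Fin (suc n) → Fin (suc n) → ℚ) →
  M zero zero ≡ 1ℚ → (∀ j → M zero (suc j) ≡ 0ℚ) →
  det (suc n) M ≡ det n (λ a b → M (suc a) (suc b))
det-unit-row n M M₀₀≡1 M₀≡0 = trans
  (cong₂ _+_ (cong (λ z → 1ℚ * z * det n (minor M zero)) M₀₀≡1)
    (sumFin-zero n λ j → trans
      (cong (λ z → altSign (suc (toℕ j)) * z * det n (minor M (suc j))) (M₀≡0 j))
      (solveℚ 2 (λ t x → t :* con 0ℚ :* x := con 0ℚ) refl
        (altSign (suc (toℕ j))) (det n (minor M (suc j))))))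
  (solveℚ 1 (λ x → con 1ℚ :* con 1ℚ :* x :+ con 0ℚ := x) refl (det n (minor M zero)))

det-scale : ∀ n (x y : Fin n → ℚ) (M : Fin n → Fin n → ℚ) →
  det n (λ a b → x a * M a b * y b) ≡ prodFin n x * prodFin n y * det n M
det-scale zero    x y M = refl
det-scale (suc n) x y M = trans
  (sumFin-cong (suc n) λ j → begin
    s j * (x zero * M zero j * y j) * det n (λ r c → x (suc r) * minor M j r c * y (punchIn j c))
      ≡⟨ cong (s j * (x zero * M zero j * y j) *_) (det-scale n (x ∘ suc) (y ∘ punchIn j) (minor M j)) ⟩
    s j * (x zero * M zero j * y j) * (X * Y j * det n (minor M j))
      ≡⟨ solveℚ 7 (λ s x₀ m y₀ X Y d → s :* (x₀ :* m :* y₀) :* (X :* Y :* d)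
                     := (x₀ :* X) :* (y₀ :* Y) :* (s :* m :* d)) refl
           (s j) (x zero) (M zero j) (y j) X (Y j) (det n (minor M j)) ⟩
    prodFin (suc n) x * (y j * Y j) * laplaceTerm n M j
      -- The entry supplies the factor `y j` that the minor lacks, so the product is the same for
      -- all `j` and leaves the sum.
      ≡⟨ cong (λ z → prodFin (suc n) x * z * laplaceTerm n M j) (prodFin-punchIn n j y) ⟩
    prodFin (suc n) x * prodFin (suc n) y * laplaceTerm n M j ∎)
  (sumFin-*ˡ (suc n) (prodFin (suc n) x * prodFin (suc n) y) (laplaceTerm n M))
  where
  open ≡-Reasoning
  s : Fin (suc n) → ℚ
  s j = altSign (toℕ j)
  X : ℚ
  X = prodFin n (x ∘ suc)
  Y : Fin (suc n) → ℚ
  Y j = prodFin n (y ∘ punchIn j)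

-- Total positivity

-- Row operations leave the choice of columns alone, so the columns are fixed in advance and only
-- rows are selected.
RowTotallyPositive : ∀ {p} → (ℕ → Fin p → ℚ) → Set
RowTotallyPositive {p} B =
  ∀ (rows : Fin p → ℕ) → StrictlyIncreasing rows → 0ℚ ≤ det p (λ a b → B (rows a) b)

RowTotallyPositive-cong : ∀ {p} {A B : ℕ → Fin p → ℚ} → (∀ l → A l ≗ B l) →
  RowTotallyPositive A → RowTotallyPositive B
RowTotallyPositive-cong {p} A≗B tp rows rows↑ =
  subst (0ℚ ≤_) (det-cong p λ a b → A≗B (rows a) b) (tp rows rows↑)

WeaklyIncreasing : ∀ {p} → (Fin p → ℕ) → Set
WeaklyIncreasing r = ∀ a b → a Fin.≤ b → r a ℕ.≤ r b

-- Repeated rows make the determinant vanish, so strictness of the row indices is irrelevant.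
weakly-increasing-minor : ∀ {p} (B : ℕ → Fin p → ℚ) → RowTotallyPositive B →
  ∀ (rows : Fin p → ℕ) → WeaklyIncreasing rows → 0ℚ ≤ det p (λ a b → B (rows a) b)
weakly-increasing-minor {zero}  B tp rows rows↗ = tp rows λ ()
weakly-increasing-minor {suc n} B tp rows rows↗
  with Finₚ.any? (λ a → rows (inject₁ a) ℕₚ.≟ rows (suc a))
... | yes (a , eq) = ℚₚ.≤-reflexive (sym (det-adjacent-equal n a (λ b → B (rows b)) λ j → cong (λ r → B r j) eq))
... | no  distinct = tp rows rows↑
  where
  rows↑ : StrictlyIncreasing rows
  rows↑ a (suc b) (s≤s a≤b) = ℕₚ.≤-<-trans
    (rows↗ a (inject₁ b) (subst (toℕ a ℕ.≤_) (sym (Finₚ.toℕ-inject₁ b)) a≤b))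
    (ℕₚ.≤∧≢⇒< (rows↗ (inject₁ b) (suc b)
                  (ℕₚ.≤-trans (ℕₚ.≤-reflexive (Finₚ.toℕ-inject₁ b)) (ℕₚ.n≤1+n (toℕ b))))
               (λ eq → distinct (b , eq)))

-- The factors come out of the minor as nonnegative products. Since `π` may identify rows, what
-- remains is a minor with weakly increasing row indices.
reindex-scale : ∀ {p} {B : ℕ → Fin p → ℚ} (π : ℕ → ℕ) (x : ℕ → ℚ) (y : Fin p → ℚ) →
  (∀ {k l} → k ℕ.≤ l → π k ℕ.≤ π l) → (∀ l → 0ℚ ≤ x l) → (∀ j → 0ℚ ≤ y j) →
  RowTotallyPositive B → RowTotallyPositive (λ l j → x l * B (π l) j * y j)
reindex-scale {p} {B} π x y π-mono 0≤x 0≤y tp rows rows↑ =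
  subst (0ℚ ≤_) (sym (det-scale p (x ∘ rows) y (λ a b → B (π (rows a)) b)))
    (*-nonNeg
      (*-nonNeg (prodFin-nonNeg p (0≤x ∘ rows)) (prodFin-nonNeg p 0≤y))
      (weakly-increasing-minor B tp (π ∘ rows) λ a b a≤b → π-mono (rows-mono a b a≤b)))
  where
  rows-mono : WeaklyIncreasing rows
  rows-mono a b a≤b with ℕₚ.m≤n⇒m<n∨m≡n a≤b
  ... | inj₁ a<b = ℕₚ.<⇒≤ (rows↑ a b a<b)
  ... | inj₂ a≡b = ℕₚ.≤-reflexive (cong rows (Finₚ.toℕ-injective a≡b))

-- If row t+1 occurs in a minor of B, the minor splits into one of A with the same rows and one
-- with row t+1 replaced by row t; the row indices of the latter still increase weakly.
add-row-to-next : ∀ {p} {A B : ℕ → Fin p → ℚ} (t : ℕ) →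
  (∀ l → l ≢ suc t → B l ≗ A l) → (∀ j → B (suc t) j ≡ A (suc t) j + A t j) →
  RowTotallyPositive A → RowTotallyPositive B
add-row-to-next {p} {A} {B} t same added tp rows rows↑
  with Finₚ.any? (λ a → rows a ℕₚ.≟ suc t)
... | no  ∉rows = subst (0ℚ ≤_)
  (sym (det-cong p λ a b → same (rows a) (λ eq → ∉rows (a , eq)) b)) (tp rows rows↑)
... | yes (a , ra≡1+t) = subst (0ℚ ≤_)
  (sym (det-additive p a _ (λ b → A (rows b)) (λ b → A (rows′ b))
    (λ b b≢a j → same (rows b) (others b b≢a) j)
    (λ b b≢a j → trans (same (rows b) (others b b≢a) j) (cong (λ r → A r j) (sym (rows′-other b b≢a))))
    (λ j → trans (cong (λ r → B r j) ra≡1+t) (trans (added j)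
      (cong₂ (λ r r′ → A r j + A r′ j) (sym ra≡1+t) (sym rows′-a))))))
  (ℚₚ.+-mono-≤ (tp rows rows↑) (weakly-increasing-minor A tp rows′ rows′↗))
  where
  rows′ : Fin p → ℕ
  rows′ = updateAt rows a (const t)
  rows′-a : rows′ a ≡ t
  rows′-a = updateAt-updates a rows
  rows′-other : ∀ b → b ≢ a → rows′ b ≡ rows b
  rows′-other b b≢a = updateAt-minimal b a rows b≢a
  others : ∀ b → b ≢ a → rows b ≢ suc t
  others b b≢a rb≡1+t with Finₚ.<-cmp b a
  ... | tri< b<a _ _ = ℕₚ.<⇒≢ (rows↑ b a b<a) (trans rb≡1+t (sym ra≡1+t))
  ... | tri≈ _ b≡a _ = b≢a b≡a
  ... | tri> _ _ a<b = ℕₚ.<⇒≢ (rows↑ a b a<b) (trans ra≡1+t (sym rb≡1+t))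
  rows′↗< : ∀ b c → b Fin.< c → rows′ b ℕ.≤ rows′ c
  rows′↗< b c b<c with b Finₚ.≟ a | c Finₚ.≟ a
  ... | yes refl | yes refl = ℕₚ.≤-refl
  ... | yes refl | no  c≢a  rewrite rows′-a | rows′-other c c≢a =
    ℕₚ.≤-trans (ℕₚ.n≤1+n t) (subst (ℕ._≤ rows c) ra≡1+t (ℕₚ.<⇒≤ (rows↑ a c b<c)))
  -- A row selected before row t+1 is at most t. Equality occurs when row t is selected too, so
  -- strictness can be lost here.
  ... | no  b≢a  | yes refl rewrite rows′-a | rows′-other b b≢a =
    ℕₚ.≤-pred (subst (rows b ℕ.<_) ra≡1+t (rows↑ b a b<c))
  ... | no  b≢a  | no  c≢a  rewrite rows′-other b b≢a | rows′-other c c≢a =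
    ℕₚ.<⇒≤ (rows↑ b c b<c)
  rows′↗ : WeaklyIncreasing rows′
  rows′↗ b c b≤c with ℕₚ.m≤n⇒m<n∨m≡n b≤c
  ... | inj₁ b<c = rows′↗< b c b<c
  ... | inj₂ b≡c = ℕₚ.≤-reflexive (cong rows′ (Finₚ.toℕ-injective b≡c))

fin-bounded : ∀ p (f : Fin p → ℕ) → ∃ λ K → ∀ a → f a ℕ.< K
fin-bounded zero    f = 0 , λ ()
fin-bounded (suc p) f with fin-bounded p (f ∘ suc)
... | K , f<K = suc (f zero) ℕ.⊔ K , λ
  { zero    → ℕₚ.m≤m⊔n (suc (f zero)) K
  ; (suc a) → ℕₚ.<-≤-trans (f<K a) (ℕₚ.m≤n⊔m (suc (f zero)) K) }

-- A minor meets finitely many rows, so it suffices to sum the rows up to some bound t. This takes t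
-- additions of a row to the next one, each covered by `add-row-to-next`.
prefix-sums : ∀ {p} {A S : ℕ → Fin p → ℚ} →
  S 0 ≗ A 0 → (∀ l j → S (suc l) j ≡ A (suc l) j + S l j) →
  RowTotallyPositive A → RowTotallyPositive S
prefix-sums {p} {A} {S} S₀ S₊ tp rows rows↑ with fin-bounded p rows
... | t , rows<t = subst (0ℚ ≤_)
  (det-cong p λ a j → summed (ℕₚ.<⇒≤ (rows<t a)) j) (partial-TP t rows rows↑)
  where
  -- Only the rows up to t are summed, so that partial (suc t) arises by adding row t to row t+1.
  partial : ℕ → ℕ → Fin p → ℚ
  partial t l j with l ℕₚ.≤? t
  ... | yes _ = S l j
  ... | no  _ = A l j
  summed : ∀ {t l} → l ℕ.≤ t → partial t l ≗ S l
  summed {t} {l} l≤t j with l ℕₚ.≤? t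
  ... | yes _  = refl
  ... | no l≰t = contradiction l≤t l≰t
  unsummed : ∀ {t l} → t ℕ.< l → partial t l ≗ A l
  unsummed {t} {l} t<l j with l ℕₚ.≤? t
  ... | yes l≤t = contradiction l≤t (ℕₚ.<⇒≱ t<l)
  ... | no _    = refl
  same : ∀ t l → l ≢ suc t → partial (suc t) l ≗ partial t l
  same t l l≢1+t j with ℕₚ.<-cmp l (suc t)
  ... | tri< l<1+t _ _ = trans (summed (ℕₚ.<⇒≤ l<1+t) j) (sym (summed (ℕₚ.≤-pred l<1+t) j))
  ... | tri≈ _ l≡1+t _ = contradiction l≡1+t l≢1+t
  ... | tri> _ _ l>1+t = trans (unsummed l>1+t j) (sym (unsummed (ℕₚ.<⇒≤ l>1+t) j))
  partial-TP : ∀ t → RowTotallyPositive (partial t)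
  partial-TP zero    = RowTotallyPositive-cong {A = A} {partial 0}
    (λ { zero j → sym (trans (summed {0} z≤n j) (S₀ j)) ; (suc l) j → sym (unsummed z<s j) }) tp
  partial-TP (suc t) = add-row-to-next {A = partial t} {partial (suc t)} t (same t)
    (λ j → trans (summed ℕₚ.≤-refl j) (trans (S₊ t j)
      (sym (cong₂ _+_ (unsummed (ℕₚ.n<1+n t) j) (summed ℕₚ.≤-refl j)))))
    (partial-TP t)

-- The direct sum 1 ⊕ A

bordered : (ℕ → ℕ → ℚ) → ℕ → ℕ → ℚ
bordered A zero    zero    = 1ℚ
bordered A zero    (suc k) = 0ℚ
bordered A (suc l) zero    = 0ℚ
bordered A (suc l) (suc k) = A l k

-- The bound on the columns serves as induction parameter: bordering raises it by one.
TotallyPositiveBelow : ℕ → (ℕ → ℕ → ℚ) → Set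
TotallyPositiveBelow K A = ∀ p (cols : Fin p → ℕ) → StrictlyIncreasing cols →
  (∀ b → cols b ℕ.< K) → RowTotallyPositive (λ l b → A l (cols b))

-- A minor that uses both row 0 and column 0 reduces to one of A by expanding along its unit row. If
-- it uses just one of them, it has a zero row or column; if neither, it is a minor of A with all
-- indices lowered by one.
bordered-TP : ∀ {K A} → TotallyPositiveBelow K A → TotallyPositiveBelow (suc K) (bordered A)
bordered-TP {K} {A} tp zero    cols cols↑ cols<K rows rows↑ = ℚₚ.nonNegative⁻¹ 1ℚ
bordered-TP {K} {A} tp (suc p) cols cols↑ cols<K rows rows↑ = go (rows zero) (cols zero) refl refl
  where
  M : Fin (suc p) → Fin (suc p) → ℚ
  M a b = bordered A (rows a) (cols b)
  inner : ∀ {l k} → 0 ℕ.< l → 0 ℕ.< k → bordered A l k ≡ A (pred l) (pred k)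
  inner {suc l} {suc k} _ _ = refl
  top : ∀ {l k} → l ≡ 0 → 0 ℕ.< k → bordered A l k ≡ 0ℚ
  top {zero} {suc k} _ _ = refl
  left : ∀ {l k} → 0 ℕ.< l → k ≡ 0 → bordered A l k ≡ 0ℚ
  left {suc l} {zero} _ _ = refl
  later : ∀ {r : Fin (suc p) → ℕ} → StrictlyIncreasing r → ∀ a → 0 ℕ.< r (suc a)
  later r↑ a = ℕₚ.≤-<-trans z≤n (r↑ zero (suc a) z<s)
  all : ∀ {r : Fin (suc p) → ℕ} → StrictlyIncreasing r → 0 ℕ.< r zero → ∀ a → 0 ℕ.< r a
  all r↑ 0<r zero    = 0<r
  all r↑ 0<r (suc a) = later r↑ a
  shifted : ∀ {q} (r c : Fin q → ℕ) → StrictlyIncreasing r → StrictlyIncreasing c →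
    (∀ a → 0 ℕ.< r a) → (∀ b → 0 ℕ.< c b) → (∀ b → c b ℕ.< suc K) →
    0ℚ ≤ det q (λ a b → bordered A (r a) (c b))
  shifted {q} r c r↑ c↑ 0<r 0<c c<K = subst (0ℚ ≤_)
    (sym (det-cong q λ a b → inner (0<r a) (0<c b)))
    (tp q (pred ∘ c) (pred-↑ c↑ 0<c)
      (λ b → ℕₚ.pred-mono-< {{ℕ.>-nonZero (0<c b)}} (c<K b))
      (pred ∘ r) (pred-↑ r↑ 0<r))
    where
    pred-↑ : ∀ {f : Fin q → ℕ} → StrictlyIncreasing f → (∀ a → 0 ℕ.< f a) →
      StrictlyIncreasing (pred ∘ f)
    pred-↑ f↑ 0<f a b a<b = ℕₚ.pred-mono-< {{ℕ.>-nonZero (0<f a)}} (f↑ a b a<b)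
  go : ∀ l k → rows zero ≡ l → cols zero ≡ k → 0ℚ ≤ det (suc p) M
  go zero    zero    r₀ c₀ = subst (0ℚ ≤_)
    (sym (det-unit-row p M (cong₂ (bordered A) r₀ c₀) (λ b → top r₀ (later cols↑ b))))
    (shifted (rows ∘ suc) (cols ∘ suc) (λ a b a<b → rows↑ (suc a) (suc b) (s≤s a<b))
      (λ a b a<b → cols↑ (suc a) (suc b) (s≤s a<b)) (later rows↑) (later cols↑) (cols<K ∘ suc))
  go zero    (suc k) r₀ c₀ = ℚₚ.≤-reflexive (sym (det-zero-row p M
    λ b → top r₀ (all cols↑ (subst (0 ℕ.<_) (sym c₀) z<s) b)))
  go (suc l) zero    r₀ c₀ = ℚₚ.≤-reflexive (sym (det-zero-column p M
    λ a → left (all rows↑ (subst (0 ℕ.<_) (sym r₀) z<s) a) c₀))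
  go (suc l) (suc k) r₀ c₀ = shifted rows cols rows↑ cols↑
    (all rows↑ (subst (0 ℕ.<_) (sym r₀) z<s)) (all cols↑ (subst (0 ℕ.<_) (sym c₀) z<s)) cols<K

-- Matching polynomials of weighted paths

fromℕ : ℕ → ℚ
fromℕ n = pos n / 1

-- The total weight of the matchings with k edges in a path on j vertices whose successive edges
-- weigh c 0, c 1, and so on. In the recursion the last vertex is either unmatched or matched along
-- the last edge.
pathMatchings : (ℕ → ℕ) → ℕ → ℕ → ℕ
pathMatchings c zero          zero    = 1
pathMatchings c zero          (suc k) = 0
pathMatchings c (suc zero)    k       = pathMatchings c zero k
pathMatchings c (suc (suc j)) zero    = pathMatchings c (suc j) zero
pathMatchings c (suc (suc j)) (suc k) = pathMatchings c (suc j) (suc k) ℕ.+ c j ℕ.* pathMatchings c j k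

-- Arithmetic of fractions of natural numbers

toℚᵘ-fromℕ : ∀ n → toℚᵘ (fromℕ n) ℚᵘ.≃ ℚᵘ.mkℚᵘ (pos n) 0
toℚᵘ-fromℕ n = ℚₚ.toℚᵘ-fromℚᵘ (ℚᵘ.mkℚᵘ (pos n) 0)

fromℕ-+ : ∀ m n → fromℕ (m ℕ.+ n) ≡ fromℕ m + fromℕ n
fromℕ-+ m n = ℚₚ.toℚᵘ-injective (begin
  toℚᵘ (fromℕ (m ℕ.+ n))                          ≈⟨ toℚᵘ-fromℕ (m ℕ.+ n) ⟩
  ℚᵘ.mkℚᵘ (pos (m ℕ.+ n)) 0
    ≈⟨ ℚᵘ.*≡* (cong (λ z → pos z ℤ.* pos 1) (cong₂ ℕ._+_ (sym (ℕₚ.*-identityʳ m)) (sym (ℕₚ.*-identityʳ n)))) ⟩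
  ℚᵘ.mkℚᵘ (pos (m ℕ.* 1 ℕ.+ n ℕ.* 1)) 0
    ≡⟨ cong (λ z → ℚᵘ.mkℚᵘ z 0) (cong₂ ℤ._+_ (ℤₚ.pos-* m 1) (ℤₚ.pos-* n 1)) ⟩
  ℚᵘ.mkℚᵘ (pos m) 0 ℚᵘ.+ ℚᵘ.mkℚᵘ (pos n) 0        ≈⟨ ℚᵘₚ.+-cong (toℚᵘ-fromℕ m) (toℚᵘ-fromℕ n) ⟨
  toℚᵘ (fromℕ m) ℚᵘ.+ toℚᵘ (fromℕ n)              ≈⟨ ℚₚ.toℚᵘ-homo-+ (fromℕ m) (fromℕ n) ⟨
  toℚᵘ (fromℕ m + fromℕ n)                        ∎)
  where open ℚᵘₚ.≃-Reasoning

/-nonNeg : ∀ n d .{{_ : ℕ.NonZero d}} → 0ℚ ≤ pos n / d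
/-nonNeg n d = ℚₚ.nonNegative⁻¹ (pos n / d) {{ℚₚ.normalize-nonNeg n d}}

/-*-/ : ∀ m n d e .{{_ : ℕ.NonZero d}} .{{_ : ℕ.NonZero e}} .{{_ : ℕ.NonZero (d ℕ.* e)}} →
  (pos m / d) * (pos n / e) ≡ pos (m ℕ.* n) / (d ℕ.* e)
/-*-/ m n (suc d) (suc e) = ℚₚ.toℚᵘ-injective (begin
  toℚᵘ ((pos m / suc d) * (pos n / suc e))
    ≈⟨ ℚₚ.toℚᵘ-homo-* (pos m / suc d) (pos n / suc e) ⟩
  toℚᵘ (pos m / suc d) ℚᵘ.* toℚᵘ (pos n / suc e)
    ≈⟨ ℚᵘₚ.*-cong (ℚₚ.toℚᵘ-fromℚᵘ (ℚᵘ.mkℚᵘ (pos m) d)) (ℚₚ.toℚᵘ-fromℚᵘ (ℚᵘ.mkℚᵘ (pos n) e)) ⟩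
  ℚᵘ.mkℚᵘ (pos m) d ℚᵘ.* ℚᵘ.mkℚᵘ (pos n) e
    ≡⟨ cong (λ z → ℚᵘ.mkℚᵘ z (pred (suc d ℕ.* suc e))) (ℤₚ.pos-* m n) ⟨
  ℚᵘ.mkℚᵘ (pos (m ℕ.* n)) (pred (suc d ℕ.* suc e))
    ≈⟨ ℚₚ.toℚᵘ-fromℚᵘ (ℚᵘ.mkℚᵘ (pos (m ℕ.* n)) (pred (suc d ℕ.* suc e))) ⟨
  toℚᵘ (pos (m ℕ.* n) / (suc d ℕ.* suc e)) ∎)
  where open ℚᵘₚ.≃-Reasoning

/-≡-/ : ∀ m n d e .{{_ : ℕ.NonZero d}} .{{_ : ℕ.NonZero e}} →
  m ℕ.* e ≡ n ℕ.* d → pos m / d ≡ pos n / e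
/-≡-/ m n (suc d) (suc e) eq = ℚₚ.fromℚᵘ-cong
  (ℚᵘ.*≡* {ℚᵘ.mkℚᵘ (pos m) d} {ℚᵘ.mkℚᵘ (pos n) e}
    (trans (sym (ℤₚ.pos-* m (suc e))) (trans (cong pos eq) (ℤₚ.pos-* n (suc d)))))

-- Total positivity of the matching coefficients

-- Induction on `K`: the first `suc K` columns of 1 ⊕ V involve only the first `K` columns of V, and
-- the increments between consecutive rows of V are multiples of rows of 1 ⊕ V.
pathMatchings-TP-below : ∀ c K → TotallyPositiveBelow K (λ j k → fromℕ (pathMatchings c j k))
pathMatchings-TP-below c zero    zero    cols cols↑ cols<0 rows rows↑ = ℚₚ.nonNegative⁻¹ 1ℚ
pathMatchings-TP-below c zero    (suc p) cols cols↑ cols<0 = contradiction (cols<0 zero) λ ()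
pathMatchings-TP-below c (suc K) p cols cols↑ cols<K = prefix-sums
  {A = λ l b → x l * bordered V (π l) (cols b) * 1ℚ} {λ l b → V l (cols b)}
  (λ b → base (cols b)) (λ l b → step l (cols b))
  (reindex-scale {B = λ l b → bordered V l (cols b)} π x (const 1ℚ) π-mono 0≤x
    (λ _ → ℚₚ.nonNegative⁻¹ 1ℚ)
    (bordered-TP {A = V} (pathMatchings-TP-below c K) p cols cols↑ cols<K))
  where
  V : ℕ → ℕ → ℚ
  V j k = fromℕ (pathMatchings c j k)
  -- V 1 repeats V 0, hence the increment at row 1 is a row of 1 ⊕ V with factor 0.
  π : ℕ → ℕ
  π zero          = zero
  π (suc zero)    = zero
  π (suc (suc l)) = suc l
  x : ℕ → ℚ
  x zero          = 1ℚ
  x (suc zero)    = 0ℚ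
  -- Row l+1 of 1 ⊕ V is row l of V moved one column to the right, that is, the coefficients of y
  -- V_l. The factor c_l makes it the difference of V_{l+2} and V_{l+1}.
  x (suc (suc l)) = fromℕ (c l)
  π-mono : ∀ {k l} → k ℕ.≤ l → π k ℕ.≤ π l
  π-mono {zero}        _                = z≤n
  π-mono {suc zero}    _                = z≤n
  π-mono {suc (suc k)} (s≤s (s≤s k≤l)) = s≤s k≤l
  0≤x : ∀ l → 0ℚ ≤ x l
  0≤x zero          = ℚₚ.nonNegative⁻¹ 1ℚ
  0≤x (suc zero)    = ℚₚ.≤-refl
  0≤x (suc (suc l)) = /-nonNeg (c l) 1
  base : ∀ k → V 0 k ≡ 1ℚ * bordered V 0 k * 1ℚ
  base zero    = refl
  base (suc k) = refl
  step : ∀ l k → V (suc l) k ≡ x (suc l) * bordered V (π (suc l)) k * 1ℚ + V l k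
  step zero    k       = solveℚ 2 (λ b v → v := con 0ℚ :* b :* con 1ℚ :+ v) refl (bordered V 0 k) (V 0 k)
  step (suc l) zero    = solveℚ 2 (λ b v → v := b :* con 0ℚ :* con 1ℚ :+ v) refl (fromℕ (c l)) (V (suc l) 0)
  step (suc l) (suc k) = trans (fromℕ-+ (pathMatchings c (suc l) (suc k)) (c l ℕ.* pathMatchings c l k))
    (trans (cong (_+_ (V (suc l) (suc k))) (sym (/-*-/ (c l) (pathMatchings c l k) 1 1)))
      (solveℚ 3 (λ u a v → u :+ a :* v := a :* v :* con 1ℚ :+ u) refl
        (V (suc l) (suc k)) (fromℕ (c l)) (V l k)))

pathMatchings-TP : ∀ c → TotallyPositive (λ j k → fromℕ (pathMatchings c j k))
pathMatchings-TP c p rows cols rows↑ cols↑ with fin-bounded p cols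
... | K , cols<K = pathMatchings-TP-below c K p cols cols↑ cols<K rows rows↑

rescale-TP : ∀ (A : ℕ → ℕ → ℚ) {B : ℕ → ℕ → ℚ} (π : ℕ → ℕ) (x y : ℕ → ℚ) →
  (∀ {k l} → k ℕ.≤ l → π k ℕ.≤ π l) → (∀ l → 0ℚ ≤ x l) → (∀ k → 0ℚ ≤ y k) →
  (∀ l k → B l k ≡ x l * A (π l) k * y k) → TotallyPositive A → TotallyPositive B
rescale-TP A π x y π-mono 0≤x 0≤y B≡ tp p rows cols rows↑ cols↑ =
  RowTotallyPositive-cong (λ l b → sym (B≡ l (cols b)))
    (reindex-scale {B = λ l b → A l (cols b)} π x (y ∘ cols) π-mono 0≤x (0≤y ∘ cols)
      (λ r r↑ → tp p r cols r↑ cols↑))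
    rows rows↑

-- Binomial coefficients

-- Induction on `n` by Pascal's rule: with (k+2) x split as x + (k+1) x, the hypothesis applies to
-- both binomials, and Pascal's rule reassembles the result.
absorption : ∀ n k → suc k ℕ.* (suc n C suc k) ≡ suc n ℕ.* (n C k)
absorption zero    zero    = refl
absorption zero    (suc k) = trans (cong (suc (suc k) ℕ.*_) (k>n⇒nCk≡0 {1} {suc (suc k)} (s≤s z<s)))
  (trans (ℕₚ.*-zeroʳ (suc (suc k))) (sym (cong (1 ℕ.*_) (k>n⇒nCk≡0 {0} {suc k} z<s))))
absorption (suc n) zero    = begin
  1 ℕ.* (suc (suc n) C 1)              ≡⟨ cong (1 ℕ.*_) (nCk+nC[k+1]≡[n+1]C[k+1] (suc n) 0) ⟨
  1 ℕ.* ((suc n C 0) ℕ.+ (suc n C 1))  ≡⟨ ℕₚ.*-distribˡ-+ 1 (suc n C 0) (suc n C 1) ⟩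
  1 ℕ.+ 1 ℕ.* (suc n C 1)              ≡⟨ cong suc (absorption n 0) ⟩
  1 ℕ.+ suc n ℕ.* 1                    ∎
  where open ≡-Reasoning
absorption (suc n) (suc k) = begin
  suc (suc k) ℕ.* (suc (suc n) C suc (suc k))
    ≡⟨ cong (suc (suc k) ℕ.*_) (nCk+nC[k+1]≡[n+1]C[k+1] (suc n) (suc k)) ⟨
  suc (suc k) ℕ.* (x ℕ.+ y)            ≡⟨ expand (suc k) x y ⟩
  x ℕ.+ (suc k ℕ.* x ℕ.+ suc (suc k) ℕ.* y)
    ≡⟨ cong (x ℕ.+_) (cong₂ ℕ._+_ (absorption n k) (absorption n (suc k))) ⟩
  x ℕ.+ (suc n ℕ.* (n C k) ℕ.+ suc n ℕ.* (n C suc k))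
    ≡⟨ cong (x ℕ.+_) (ℕₚ.*-distribˡ-+ (suc n) (n C k) (n C suc k)) ⟨
  x ℕ.+ suc n ℕ.* ((n C k) ℕ.+ (n C suc k))
    ≡⟨ cong (λ z → x ℕ.+ suc n ℕ.* z) (nCk+nC[k+1]≡[n+1]C[k+1] n k) ⟩
  suc (suc n) ℕ.* x                    ∎
  where
  open ≡-Reasoning
  x y : ℕ
  x = suc n C suc k
  y = suc n C suc (suc k)
  expand : ∀ k x y → suc k ℕ.* (x ℕ.+ y) ≡ x ℕ.+ (k ℕ.* x ℕ.+ suc k ℕ.* y)
  expand = solve-∀

-- The factorial formula with denominators cleared, in terms of the two complementary parts so that
-- no subtraction appears.
C-factorial : ∀ j k → ((j ℕ.+ k) C k) ℕ.* (k ! ℕ.* j !) ≡ (j ℕ.+ k) !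
C-factorial j k = begin
  ((j ℕ.+ k) C k) ℕ.* (k ! ℕ.* j !)
    ≡⟨ cong (λ z → ((j ℕ.+ k) C k) ℕ.* (k ! ℕ.* z !)) (ℕₚ.m+n∸n≡m j k) ⟨
  ((j ℕ.+ k) C k) ℕ.* (k ! ℕ.* (j ℕ.+ k ℕ.∸ k) !)
    ≡⟨ cong (ℕ._* (k ! ℕ.* (j ℕ.+ k ℕ.∸ k) !)) (nCk≡n!/k![n-k]! k≤j+k) ⟩
  ((j ℕ.+ k) ! ℕ./ (k ! ℕ.* (j ℕ.+ k ℕ.∸ k) !)) ℕ.* (k ! ℕ.* (j ℕ.+ k ℕ.∸ k) !)
    ≡⟨ m/n*n≡m (k![n∸k]!∣n! k≤j+k) ⟩
  (j ℕ.+ k) ! ∎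
  where
  open ≡-Reasoning
  k≤j+k : k ℕ.≤ j ℕ.+ k
  k≤j+k = ℕₚ.m≤n+m k j
  instance
    _ : ℕ.NonZero (k ! ℕ.* (j ℕ.+ k ℕ.∸ k) !)
    _ = k ℕₚ.!* (j ℕ.+ k ℕ.∸ k) !≢0

-- Closed forms for the interleaved weights

-- The sequence s+1, 1, s+2, 2, s+3, 3, and so on.
narayanaWeight : ℕ → ℕ → ℕ
narayanaWeight s zero          = suc s
narayanaWeight s (suc zero)    = 1
narayanaWeight s (suc (suc j)) = suc (narayanaWeight s j)

narayanaWeight-even : ∀ s i → narayanaWeight s (i ℕ.* 2) ≡ suc (i ℕ.+ s)
narayanaWeight-even s zero    = refl
narayanaWeight-even s (suc i) = cong suc (narayanaWeight-even s i)

narayanaWeight-odd : ∀ s i → narayanaWeight s (suc (i ℕ.* 2)) ≡ suc i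
narayanaWeight-odd s zero    = refl
narayanaWeight-odd s (suc i) = cong suc (narayanaWeight-odd s i)

-- The right-hand sides count placements of k non-attacking rooks on boards of size i × (i+s) and,
-- for odd indices, i × (i+s+1). Each step adds a row or a column to the board: the new line is
-- empty, or holds a rook in one of as many places as the weight says.
pathMatchings-even : ∀ s i k → pathMatchings (narayanaWeight s) (i ℕ.* 2) k ≡
  k ! ℕ.* ((i C k) ℕ.* ((i ℕ.+ s) C k))
pathMatchings-odd : ∀ s i k → pathMatchings (narayanaWeight s) (suc (i ℕ.* 2)) k ≡
  k ! ℕ.* ((i C k) ℕ.* (suc (i ℕ.+ s) C k))

pathMatchings-even s zero    zero    = refl
pathMatchings-even s zero    (suc k) = sym
  (trans (cong (λ z → suc k ! ℕ.* (z ℕ.* (s C suc k))) (k>n⇒nCk≡0 {0} {suc k} z<s)) (ℕₚ.*-zeroʳ (suc k !)))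
pathMatchings-even s (suc i) zero    = pathMatchings-odd s i zero
pathMatchings-even s (suc i) (suc k) = begin
  pathMatchings w (suc (i ℕ.* 2)) (suc k) ℕ.+ w (i ℕ.* 2) ℕ.* pathMatchings w (i ℕ.* 2) k
    ≡⟨ cong₂ ℕ._+_ (pathMatchings-odd s i (suc k))
         (cong₂ ℕ._*_ (narayanaWeight-even s i) (pathMatchings-even s i k)) ⟩
  suc k ! ℕ.* (b ℕ.* d) ℕ.+ suc (i ℕ.+ s) ℕ.* (k ! ℕ.* (a ℕ.* e))
    ≡⟨ collect (suc k ! ℕ.* (b ℕ.* d)) (suc (i ℕ.+ s)) (k !) a e ⟩
  suc k ! ℕ.* (b ℕ.* d) ℕ.+ k ! ℕ.* (a ℕ.* (suc (i ℕ.+ s) ℕ.* e))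
    -- Absorption gives both summands the common factor `d`; Pascal's rule then acts on the other
    -- binomial.
    ≡⟨ cong (λ z → suc k ! ℕ.* (b ℕ.* d) ℕ.+ k ! ℕ.* (a ℕ.* z)) (absorption (i ℕ.+ s) k) ⟨
  suc k ! ℕ.* (b ℕ.* d) ℕ.+ k ! ℕ.* (a ℕ.* (suc k ℕ.* d))
    ≡⟨ factor (suc k) (k !) a b d ⟩
  suc k ! ℕ.* ((a ℕ.+ b) ℕ.* d)
    ≡⟨ cong (λ z → suc k ! ℕ.* (z ℕ.* d)) (nCk+nC[k+1]≡[n+1]C[k+1] i k) ⟩
  suc k ! ℕ.* ((suc i C suc k) ℕ.* d) ∎
  where
  open ≡-Reasoning
  w : ℕ → ℕ
  w = narayanaWeight s
  a b d e : ℕ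
  a = i C k
  b = i C suc k
  d = suc (i ℕ.+ s) C suc k
  e = (i ℕ.+ s) C k
  collect : ∀ u n f a e → u ℕ.+ n ℕ.* (f ℕ.* (a ℕ.* e)) ≡ u ℕ.+ f ℕ.* (a ℕ.* (n ℕ.* e))
  collect = solve-∀
  factor : ∀ n f a b d →
    n ℕ.* f ℕ.* (b ℕ.* d) ℕ.+ f ℕ.* (a ℕ.* (n ℕ.* d)) ≡ n ℕ.* f ℕ.* ((a ℕ.+ b) ℕ.* d)
  factor = solve-∀

pathMatchings-odd s zero    zero    = refl
pathMatchings-odd s zero    (suc k) = sym
  (trans (cong (λ z → suc k ! ℕ.* (z ℕ.* (suc s C suc k))) (k>n⇒nCk≡0 {0} {suc k} z<s)) (ℕₚ.*-zeroʳ (suc k !)))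
pathMatchings-odd s (suc i) zero    = pathMatchings-even s (suc i) zero
pathMatchings-odd s (suc i) (suc k) = begin
  pathMatchings w (suc i ℕ.* 2) (suc k) ℕ.+ w (suc (i ℕ.* 2)) ℕ.* pathMatchings w (suc (i ℕ.* 2)) k
    ≡⟨ cong₂ ℕ._+_ (pathMatchings-even s (suc i) (suc k))
         (cong₂ ℕ._*_ (narayanaWeight-odd s i) (pathMatchings-odd s i k)) ⟩
  suc k ! ℕ.* (b ℕ.* d) ℕ.+ suc i ℕ.* (k ! ℕ.* (a ℕ.* e))
    ≡⟨ collect (suc k ! ℕ.* (b ℕ.* d)) (suc i) (k !) a e ⟩
  suc k ! ℕ.* (b ℕ.* d) ℕ.+ k ! ℕ.* (suc i ℕ.* a ℕ.* e)
    -- The two binomials exchange roles: absorption acts on the first and Pascal's rule on the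
    -- second.
    ≡⟨ cong (λ z → suc k ! ℕ.* (b ℕ.* d) ℕ.+ k ! ℕ.* (z ℕ.* e)) (absorption i k) ⟨
  suc k ! ℕ.* (b ℕ.* d) ℕ.+ k ! ℕ.* (suc k ℕ.* b ℕ.* e)
    ≡⟨ factor (suc k) (k !) b d e ⟩
  suc k ! ℕ.* (b ℕ.* (e ℕ.+ d))
    ≡⟨ cong (λ z → suc k ! ℕ.* (b ℕ.* z)) (nCk+nC[k+1]≡[n+1]C[k+1] (suc (i ℕ.+ s)) k) ⟩
  suc k ! ℕ.* (b ℕ.* (suc (suc (i ℕ.+ s)) C suc k)) ∎
  where
  open ≡-Reasoning
  w : ℕ → ℕ
  w = narayanaWeight s
  a b d e : ℕ
  a = i C k
  b = suc i C suc k
  d = suc (i ℕ.+ s) C suc k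
  e = suc (i ℕ.+ s) C k
  collect : ∀ u n f a e → u ℕ.+ n ℕ.* (f ℕ.* (a ℕ.* e)) ≡ u ℕ.+ f ℕ.* (n ℕ.* a ℕ.* e)
  collect = solve-∀
  factor : ∀ n f b d e →
    n ℕ.* f ℕ.* (b ℕ.* d) ℕ.+ f ℕ.* (n ℕ.* b ℕ.* e) ≡ n ℕ.* f ℕ.* (b ℕ.* (e ℕ.+ d))
  factor = solve-∀

-- Both matrices as rescaled even rows

narayanaPath : ℕ → ℕ → ℕ → ℚ
narayanaPath s j k = fromℕ (pathMatchings (narayanaWeight s) j k)

-- Accounts for the entries that both matrices set to 0 by definition.
narayanaPath-above-diagonal : ∀ s i k → i ℕ.< k → narayanaPath s (i ℕ.* 2) k ≡ 0ℚ
narayanaPath-above-diagonal s i k i<k = cong fromℕ (begin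
  pathMatchings (narayanaWeight s) (i ℕ.* 2) k  ≡⟨ pathMatchings-even s i k ⟩
  k ! ℕ.* ((i C k) ℕ.* ((i ℕ.+ s) C k))
    ≡⟨ cong (λ z → k ! ℕ.* (z ℕ.* ((i ℕ.+ s) C k))) (k>n⇒nCk≡0 i<k) ⟩
  k ! ℕ.* 0                                     ≡⟨ ℕₚ.*-zeroʳ (k !) ⟩
  0                                             ∎)
  where open ≡-Reasoning

-- Cross-multiplication turns each of the two scaling identities into an equation between natural
-- numbers.
scaled-fraction : ∀ a d r e v f .{{_ : ℕ.NonZero d}} .{{_ : ℕ.NonZero e}} .{{_ : ℕ.NonZero f}} →
  a ℕ.* (e ℕ.* f) ≡ r ℕ.* v ℕ.* d → pos a / d ≡ (pos r / e) * fromℕ v * (pos 1 / f)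
scaled-fraction a d r e@(suc _) v f@(suc _) eq = begin
  pos a / d
    ≡⟨ /-≡-/ a (r ℕ.* v ℕ.* 1) d (e ℕ.* 1 ℕ.* f)
         (trans (cong (λ z → a ℕ.* (z ℕ.* f)) (ℕₚ.*-identityʳ e))
           (trans eq (cong (ℕ._* d) (sym (ℕₚ.*-identityʳ (r ℕ.* v)))))) ⟩
  pos (r ℕ.* v ℕ.* 1) / (e ℕ.* 1 ℕ.* f)    ≡⟨ /-*-/ (r ℕ.* v) 1 (e ℕ.* 1) f ⟨
  pos (r ℕ.* v) / (e ℕ.* 1) * (pos 1 / f)  ≡⟨ cong (_* (pos 1 / f)) (/-*-/ r v e 1) ⟨
  (pos r / e) * fromℕ v * (pos 1 / f)      ∎
  where open ≡-Reasoning

NA-below-diagonal : ∀ m i k → k ℕ.≤ i → NA m i k ≡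
  pos (suc m ℕ.* (suc (suc (m ℕ.+ i)) C suc k) ℕ.* (i C k)) / suc (suc (m ℕ.+ i))
NA-below-diagonal m i k k≤i with k ℕ.≤? i
... | yes _   = refl
... | no  k≰i = contradiction k≤i k≰i

-- By absorption C(n+2,k+1)/(n+2) = C(n+1,k)/(k+1), and n+1 = i+(m+1) makes the binomials those of
-- the closed form with s = m+1.
NA-scaled : ∀ m i k → NA m i k ≡
  (pos (suc m) / 1) * narayanaPath (suc m) (i ℕ.* 2) k * (pos 1 / (suc k !)) {{suc k ℕₚ.!≢0}}
NA-scaled m i k = go (k ℕ.≤? i)
  where
  open ≡-Reasoning
  instance
    _ : ℕ.NonZero (suc k !)
    _ = suc k ℕₚ.!≢0
  n v : ℕ
  n = m ℕ.+ i
  v = pathMatchings (narayanaWeight (suc m)) (i ℕ.* 2) k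
  identity : suc m ℕ.* (suc (suc n) C suc k) ℕ.* (i C k) ℕ.* (1 ℕ.* suc k !) ≡
    suc m ℕ.* v ℕ.* suc (suc n)
  identity = begin
    suc m ℕ.* (suc (suc n) C suc k) ℕ.* (i C k) ℕ.* (1 ℕ.* suc k !)
      ≡⟨ before (suc m) (suc (suc n) C suc k) (i C k) (suc k) (k !) ⟩
    suc m ℕ.* (k ! ℕ.* ((i C k) ℕ.* (suc k ℕ.* (suc (suc n) C suc k))))
      ≡⟨ cong (λ z → suc m ℕ.* (k ! ℕ.* ((i C k) ℕ.* z))) (absorption (suc n) k) ⟩
    suc m ℕ.* (k ! ℕ.* ((i C k) ℕ.* (suc (suc n) ℕ.* (suc n C k))))
      ≡⟨ after (suc m) (k !) (i C k) (suc (suc n)) (suc n C k) ⟩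
    suc m ℕ.* (k ! ℕ.* ((i C k) ℕ.* (suc n C k))) ℕ.* suc (suc n)
      ≡⟨ cong (λ z → suc m ℕ.* (k ! ℕ.* ((i C k) ℕ.* (z C k))) ℕ.* suc (suc n))
           (trans (cong suc (ℕₚ.+-comm m i)) (sym (ℕₚ.+-suc i m))) ⟩
    suc m ℕ.* (k ! ℕ.* ((i C k) ℕ.* ((i ℕ.+ suc m) C k))) ℕ.* suc (suc n)
      ≡⟨ cong (λ z → suc m ℕ.* z ℕ.* suc (suc n)) (pathMatchings-even (suc m) i k) ⟨
    suc m ℕ.* v ℕ.* suc (suc n) ∎
    where
    before : ∀ a x y b f → a ℕ.* x ℕ.* y ℕ.* (1 ℕ.* (b ℕ.* f)) ≡ a ℕ.* (f ℕ.* (y ℕ.* (b ℕ.* x)))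
    before = solve-∀
    after : ∀ a f y n z → a ℕ.* (f ℕ.* (y ℕ.* (n ℕ.* z))) ≡ a ℕ.* (f ℕ.* (y ℕ.* z)) ℕ.* n
    after = solve-∀
  above : i ℕ.< k → NA m i k ≡ 0ℚ
  above i<k with k ℕ.≤? i
  ... | yes k≤i = contradiction k≤i (ℕₚ.<⇒≱ i<k)
  ... | no _    = refl
  go : Dec (k ℕ.≤ i) → NA m i k ≡ (pos (suc m) / 1) * fromℕ v * (pos 1 / (suc k !))
  go (yes k≤i) = trans (NA-below-diagonal m i k k≤i)
    (scaled-fraction (suc m ℕ.* (suc (suc n) C suc k) ℕ.* (i C k)) (suc (suc n)) (suc m) 1 v (suc k !) identity)
  go (no  k≰i) = trans (above (ℕₚ.≰⇒> k≰i)) (sym (trans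
    (cong (λ z → (pos (suc m) / 1) * z * (pos 1 / (suc k !)))
      (narayanaPath-above-diagonal (suc m) i k (ℕₚ.≰⇒> k≰i)))
    (solveℚ 2 (λ x y → x :* con 0ℚ :* y := con 0ℚ) refl (pos (suc m) / 1) (pos 1 / (suc k !)))))

-- With j = i-k, multiplying by (j+1)! completes C(n+2,j+1) on the left to (n+2)! and C(i+1,k) k! on
-- the right to (i+1)!. Both sides become (m+1) C(i,k) (i+1)! (n+2)!, and the nonzero factor is
-- cancelled.
NA-reversed-numerator : ∀ m j k → let i = j ℕ.+ k ; n = m ℕ.+ i in
  suc m ℕ.* (suc (suc n) C suc j) ℕ.* (i C j) ℕ.* (suc i ! ℕ.* (k ℕ.+ suc m) !) ≡
  suc m ℕ.* suc n ! ℕ.* pathMatchings (narayanaWeight 1) (i ℕ.* 2) k ℕ.* suc (suc n)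
NA-reversed-numerator m j k = ℕₚ.*-cancelʳ-≡ _ _ (suc j !) {{suc j ℕₚ.!≢0}} (begin
  suc m ℕ.* X ℕ.* (i C j) ℕ.* (suc i ! ℕ.* (k ℕ.+ suc m) !) ℕ.* suc j !
    ≡⟨ before (suc m) X (i C j) (suc i !) ((k ℕ.+ suc m) !) (suc j !) ⟩
  suc m ℕ.* (i C j) ℕ.* suc i ! ℕ.* (X ℕ.* (suc j ! ℕ.* (k ℕ.+ suc m) !))
    ≡⟨ cong₂ (λ u z → suc m ℕ.* u ℕ.* suc i ! ℕ.* z) symmetric X-factorial ⟩
  suc m ℕ.* (i C k) ℕ.* suc i ! ℕ.* suc (suc n) !
    ≡⟨ cong (λ z → suc m ℕ.* (i C k) ℕ.* z ℕ.* suc (suc n) !) Z-factorial ⟨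
  suc m ℕ.* (i C k) ℕ.* (Z ℕ.* (k ! ℕ.* suc j !)) ℕ.* suc (suc n) !
    ≡⟨ after (suc m) (i C k) Z (k !) (suc j !) (suc (suc n)) (suc n !) ⟩
  suc m ℕ.* suc n ! ℕ.* (k ! ℕ.* ((i C k) ℕ.* Z)) ℕ.* suc (suc n) ℕ.* suc j !
    ≡⟨ cong (λ z → suc m ℕ.* suc n ! ℕ.* z ℕ.* suc (suc n) ℕ.* suc j !) (pathMatchings-even 1 i k) ⟨
  suc m ℕ.* suc n ! ℕ.* pathMatchings (narayanaWeight 1) (i ℕ.* 2) k ℕ.* suc (suc n) ℕ.* suc j ! ∎)
  where
  open ≡-Reasoning
  i n X Z : ℕ
  i = j ℕ.+ k
  n = m ℕ.+ i
  X = suc (suc n) C suc j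
  Z = (i ℕ.+ 1) C k
  symmetric : i C j ≡ i C k
  symmetric = trans (cong (i C_) (sym (ℕₚ.m+n∸n≡m j k))) (sym (nCk≡nC[n∸k] (ℕₚ.m≤n+m k j)))
  X-factorial : X ℕ.* (suc j ! ℕ.* (k ℕ.+ suc m) !) ≡ suc (suc n) !
  X-factorial = subst (λ z → (z C suc j) ℕ.* (suc j ! ℕ.* (k ℕ.+ suc m) !) ≡ z !)
    (rearrange j k m) (C-factorial (k ℕ.+ suc m) (suc j))
    where
    rearrange : ∀ j k m → k ℕ.+ suc m ℕ.+ suc j ≡ suc (suc (m ℕ.+ (j ℕ.+ k)))
    rearrange = solve-∀
  Z-factorial : Z ℕ.* (k ! ℕ.* suc j !) ≡ suc i !
  Z-factorial = trans (cong (λ z → (z C k) ℕ.* (k ! ℕ.* suc j !)) (ℕₚ.+-comm i 1)) (C-factorial (suc j) k)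
  before : ∀ a x y e f g → a ℕ.* x ℕ.* y ℕ.* (e ℕ.* f) ℕ.* g ≡ a ℕ.* y ℕ.* e ℕ.* (x ℕ.* (g ℕ.* f))
  before = solve-∀
  after : ∀ a y z h g n p →
    a ℕ.* y ℕ.* (z ℕ.* (h ℕ.* g)) ℕ.* (n ℕ.* p) ≡ a ℕ.* p ℕ.* (h ℕ.* (y ℕ.* z)) ℕ.* n ℕ.* g
  after = solve-∀

NArevMatrix-scaled : ∀ m i k → NArevMatrix m i k ≡
  (pos (suc m ℕ.* suc (m ℕ.+ i) !) / (suc i !)) {{suc i ℕₚ.!≢0}} * narayanaPath 1 (i ℕ.* 2) k
    * (pos 1 / ((k ℕ.+ suc m) !)) {{(k ℕ.+ suc m) ℕₚ.!≢0}}
NArevMatrix-scaled m i k with k ℕ.≤? i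
... | yes k≤i = trans (NA-below-diagonal m i (i ℕ.∸ k) (ℕₚ.m∸n≤m i k))
  (scaled-fraction (suc m ℕ.* (suc (suc (m ℕ.+ i)) C suc (i ℕ.∸ k)) ℕ.* (i C (i ℕ.∸ k)))
    (suc (suc (m ℕ.+ i))) (suc m ℕ.* suc (m ℕ.+ i) !) (suc i !)
    (pathMatchings (narayanaWeight 1) (i ℕ.* 2) k) ((k ℕ.+ suc m) !)
    {{_}} {{suc i ℕₚ.!≢0}} {{(k ℕ.+ suc m) ℕₚ.!≢0}}
    -- Only the occurrences of i that stand for j+k are transported along (i-k)+k = i; those inside
    -- `i ∸ k` stay fixed as j.
    (subst (λ i′ → suc m ℕ.* (suc (suc (m ℕ.+ i′)) C suc (i ℕ.∸ k)) ℕ.* (i′ C (i ℕ.∸ k))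
                     ℕ.* (suc i′ ! ℕ.* (k ℕ.+ suc m) !) ≡
                   suc m ℕ.* suc (m ℕ.+ i′) ! ℕ.* pathMatchings (narayanaWeight 1) (i′ ℕ.* 2) k
                     ℕ.* suc (suc (m ℕ.+ i′)))
      (ℕₚ.m∸n+n≡m k≤i) (NA-reversed-numerator m (i ℕ.∸ k) k)))
... | no  k≰i = sym (trans
  (cong (λ z → x * z * y) (narayanaPath-above-diagonal 1 i k (ℕₚ.≰⇒> k≰i)))
  (solveℚ 2 (λ x y → x :* con 0ℚ :* y := con 0ℚ) refl x y))
  where
  x y : ℚ
  x = (pos (suc m ℕ.* suc (m ℕ.+ i) !) / (suc i !)) {{suc i ℕₚ.!≢0}}
  y = (pos 1 / ((k ℕ.+ suc m) !)) {{(k ℕ.+ suc m) ℕₚ.!≢0}}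

theorem2p3 : (m : ℕ) → TotallyPositive (NAmatrix m) × TotallyPositive (NArevMatrix m)
theorem2p3 m =
  rescale-TP (narayanaPath (suc m)) (ℕ._* 2) (λ _ → pos (suc m) / 1) (λ k → (pos 1 / (suc k !)) {{suc k ℕₚ.!≢0}})
    (ℕₚ.*-monoˡ-≤ 2) (λ _ → /-nonNeg (suc m) 1) (λ k → /-nonNeg 1 (suc k !) {{suc k ℕₚ.!≢0}})
    (NA-scaled m) (pathMatchings-TP (narayanaWeight (suc m))) ,
  rescale-TP (narayanaPath 1) (ℕ._* 2) (λ i → (pos (suc m ℕ.* suc (m ℕ.+ i) !) / (suc i !)) {{suc i ℕₚ.!≢0}})
    (λ k → (pos 1 / ((k ℕ.+ suc m) !)) {{(k ℕ.+ suc m) ℕₚ.!≢0}})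
    (ℕₚ.*-monoˡ-≤ 2) (λ i → /-nonNeg (suc m ℕ.* suc (m ℕ.+ i) !) (suc i !) {{suc i ℕₚ.!≢0}})
    (λ k → /-nonNeg 1 ((k ℕ.+ suc m) !) {{(k ℕ.+ suc m) ℕₚ.!≢0}})
    (NArevMatrix-scaled m) (pathMatchings-TP (narayanaWeight 1))
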